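{- Let $G^g,H^h$ be games with activeness. If $G^g$ is canonical and $G^g=H^h$, then $G^g$ is covered by $H^h$.
   Context: Let $\mathcal{B}=\{0,1\}$. Define $\mathbb{I}_0=\{\emptyset\}\times\mathcal{B}$ and $\mathbb{I}_n=2^{\mathbb{I}_{n-1}}\times\mathcal{B}$ for $n\ge1$; a game with activeness is an element of $\mathbb{I}=\bigcup_{n\ge0}\mathbb{I}_n$. A pair $(G,g)$ is written $G^g$; elements of $G$ are its options, $g=1$ meaning active. The outcome $o$ is defined recursively: $o(G^g)=\mathscr{N}$ if $g=1$ and some option has outcome $\mathscr{P}$, and $o(G^g)=\mathscr{P}$ otherwise. The sum is $G^g+H^h=(\{G'^{g'}+H^h:G'^{g'}\in G^g\}\cup\{G^g+H'^{h'}:H'^{h'}\in H^h\})^{\max\{g,h\}}$. $G^g=H^h$ means $o(G^g+X^x)=o(H^h+X^x)$ for all games $X^x$. $G^g$ is covered by $H^h$ if for every option $G'^{g'}$ of $G^g$ there is an option $H'^{h'}$ of $H^h$ with $G'^{g'}=H'^{h'}$. An option $G'^{g'}$ of $G^g$ is reversible if some $G''^{g''}\in G'^{g'}$ satisfies $G''^{g''}=G^g$; a game is canonical (recursively) if all its options are canonical and none of its options is reversible. -}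

module Defs where

open import Data.Bool using (Bool; true; false; _∨_; _∧_)
open import Data.List using (List; []; _∷_; _++_)
open import Data.List.Membership.Propositional using (_∈_)
open import Data.Product using (∃-syntax; _×_)
open import Relation.Binary.PropositionalEquality using (_≡_)
open import Relation.Nullary using (¬_)

-- A game with activeness G^g: a finite collection of options together with
-- an activeness bit g (true = active).  The options are listed; all notions
-- below are invariant under reordering / duplication of options.
data Game : Set where
  mk : List Game → Bool → Game

options : Game → List Game
options (mk Gs _) = Gs

activeness : Game → Bool
activeness (mk _ g) = g

data Outcome : Set where
  𝒩 𝒫 : Outcome

mutual
  isN : Game → Bool
  isN (mk Gs g) = g ∧ anyP Gs

  anyP : List Game → Bool
  anyP [] = false
  anyP (G ∷ Gs) = notB (isN G) ∨ anyP Gs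

  notB : Bool → Bool
  notB true = false
  notB false = true

o : Game → Outcome
o G with isN G
... | true = 𝒩
... | false = 𝒫

mutual
  _⊕_ : Game → Game → Game
  G@(mk Gs g) ⊕ H@(mk Hs h) = mk (sumL Gs H ++ sumR G Hs) (g ∨ h)

  sumL : List Game → Game → List Game
  sumL [] H = []
  sumL (G' ∷ Gs) H = (G' ⊕ H) ∷ sumL Gs H

  sumR : Game → List Game → List Game
  sumR G [] = []
  sumR G (H' ∷ Hs) = (G ⊕ H') ∷ sumR G Hs

infixl 6 _⊕_

_≈_ : Game → Game → Set
G ≈ H = ∀ (X : Game) → o (G ⊕ X) ≡ o (H ⊕ X)

infix 4 _≈_

CoveredBy : Game → Game → Set
CoveredBy G H = ∀ {G'} → G' ∈ options G → ∃[ H' ] (H' ∈ options H × G' ≈ H')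

-- The option G' of G is reversible (membership G' ∈ options G stated separately).
Reversible : Game → Game → Set
Reversible G G' = ∃[ G'' ] (G'' ∈ options G' × G'' ≈ G)

data Canonical : Game → Set where
  canonical : ∀ {G} →
    (∀ {G'} → G' ∈ options G → Canonical G') →
    (∀ {G'} → G' ∈ options G → ¬ Reversible G G') →
    Canonical G

{-# OPTIONS --safe #-}

-- Suppose some option G' of G equals no option of H.  Canonicity says that no
-- option of G' equals G = H.  Under these two conditions G' and H are linked:
-- there is an active T for which both G' + T and H + T are 𝒫-positions.  Then
-- G + T is 𝒩 by the move to G' + T, contradicting G = H.
--
-- T is assembled from games separating pairs of unequal games.  Since equality
-- quantifies over all games, such separating games cannot be extracted from
-- its negation constructively.  Instead, for any two games we either prove
-- equality or construct a separating game, by recursion along options.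
module Submission where

open import Defs

open import Data.Bool using (true; false; _∨_)
open import Data.Bool.Properties using (∨-zeroʳ; ¬-not)
open import Data.Empty using (⊥)
open import Data.List using (List; []; _∷_; _++_; map)
open import Data.List.Membership.Propositional using (_∈_; mapWith∈)
open import Data.List.Membership.Propositional.Properties using (∈-map⁺; ∈-map⁻; ∈-++⁺ˡ; ∈-++⁺ʳ; ∈-++⁻)
open import Data.List.Relation.Unary.Any.Properties using (mapWith∈⁺; mapWith∈⁻)
open import Data.List.Relation.Unary.Any using (here; there)
open import Data.Product using (∃-syntax; _×_; _,_; proj₁)
open import Data.Sum using (_⊎_; inj₁; inj₂; map₁) renaming (swap to ⊎-swap)
open import Function using (_∘_)
open import Induction.WellFounded using (WellFounded; Acc; acc; module All)
open import Level using (0ℓ)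
open import Relation.Binary.Construct.Closure.Transitive using ([_]; _∷_; wellFounded)
open import Relation.Binary.PropositionalEquality using (_≡_; refl; sym; trans; cong; cong₂; subst)
open import Relation.Nullary using (contradiction)

private
  variable
    A B C A' B' : Game

-- Outcomes and moves

IsN IsP Active Inactive : Game → Set
IsN A = isN A ≡ true
IsP A = isN A ≡ false
Active A = activeness A ≡ true
Inactive A = activeness A ≡ false

bool-cases : ∀ b → b ≡ true ⊎ b ≡ false
bool-cases true = inj₁ refl
bool-cases false = inj₂ refl

N-P-disjoint : IsN A → IsP A → ⊥
N-P-disjoint n p with () ← trans (sym n) p

anyP-intro : ∀ {As} → A ∈ As → IsP A → anyP As ≡ true
anyP-intro (here refl) p rewrite p = refl
anyP-intro {As = B ∷ _} (there m) p rewrite anyP-intro m p = ∨-zeroʳ (notB (isN B))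

anyP-elim : ∀ As → anyP As ≡ true → ∃[ A ] (A ∈ As × IsP A)
anyP-elim (A ∷ As) e with isN A in eq
... | false = A , here refl , eq
... | true with anyP-elim As e
...   | B , m , p = B , there m , p

N-intro : Active A → A' ∈ options A → IsP A' → IsN A
N-intro {mk _ true} refl m p = anyP-intro m p

N-elim : IsN A → Active A × ∃[ A' ] (A' ∈ options A × IsP A')
N-elim {mk As true} n = refl , anyP-elim As n

P-inactive : Inactive A → IsP A
P-inactive {mk _ false} refl = refl

P-intro : (∀ {A'} → A' ∈ options A → IsN A') → IsP A
P-intro {A} f = ¬-not λ n → let (_ , A' , m , p) = N-elim {A} n in N-P-disjoint {A'} (f m) p

sumL≡map : ∀ As B → sumL As B ≡ map (_⊕ B) As
sumL≡map [] B = refl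
sumL≡map (A ∷ As) B = cong (A ⊕ B ∷_) (sumL≡map As B)

sumR≡map : ∀ A Bs → sumR A Bs ≡ map (A ⊕_) Bs
sumR≡map A [] = refl
sumR≡map A (B ∷ Bs) = cong (A ⊕ B ∷_) (sumR≡map A Bs)

options-⊕ : ∀ A B → options (A ⊕ B) ≡ map (_⊕ B) (options A) ++ map (A ⊕_) (options B)
options-⊕ A@(mk As _) B@(mk Bs _) = cong₂ _++_ (sumL≡map As B) (sumR≡map A Bs)

activeness-⊕ : ∀ A B → activeness (A ⊕ B) ≡ activeness A ∨ activeness B
activeness-⊕ (mk _ _) (mk _ _) = refl

active-⊕ : ∀ A B → Active A ⊎ Active B → Active (A ⊕ B)
active-⊕ A B (inj₁ a) = trans (activeness-⊕ A B) (cong (_∨ activeness B) a)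
active-⊕ A B (inj₂ b) = trans (activeness-⊕ A B) (trans (cong (activeness A ∨_) b) (∨-zeroʳ _))

active-⊕⁻ : ∀ A B → Active (A ⊕ B) → Active A ⊎ Active B
active-⊕⁻ (mk _ true) (mk _ _) _ = inj₁ refl
active-⊕⁻ (mk _ false) (mk _ _) e = inj₂ e

P-inactive-⊕ : ∀ A B → Inactive A → Inactive B → IsP (A ⊕ B)
P-inactive-⊕ A B a b = P-inactive {A ⊕ B} (trans (activeness-⊕ A B) (cong₂ _∨_ a b))

∈-⊕⁻ : ∀ A B → C ∈ options (A ⊕ B) →
       (∃[ A' ] (A' ∈ options A × C ≡ A' ⊕ B)) ⊎ (∃[ B' ] (B' ∈ options B × C ≡ A ⊕ B'))
∈-⊕⁻ {C} A B m with ∈-++⁻ (map (_⊕ B) (options A)) (subst (C ∈_) (options-⊕ A B) m)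
... | inj₁ l = inj₁ (∈-map⁻ (_⊕ B) l)
... | inj₂ r = inj₂ (∈-map⁻ (A ⊕_) r)

N-left : ∀ A B → Active A ⊎ Active B → A' ∈ options A → IsP (A' ⊕ B) → IsN (A ⊕ B)
N-left {A'} A B a m = N-intro {A ⊕ B} {A' ⊕ B} (active-⊕ A B a)
  (subst (_ ∈_) (sym (options-⊕ A B)) (∈-++⁺ˡ (∈-map⁺ (_⊕ B) m)))

N-right : ∀ A B → Active A ⊎ Active B → B' ∈ options B → IsP (A ⊕ B') → IsN (A ⊕ B)
N-right {B'} A B a m = N-intro {A ⊕ B} {A ⊕ B'} (active-⊕ A B a)
  (subst (_ ∈_) (sym (options-⊕ A B)) (∈-++⁺ʳ (map (_⊕ B) (options A)) (∈-map⁺ (A ⊕_) m)))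

N-⊕⁻ : ∀ A B → IsN (A ⊕ B) → (Active A ⊎ Active B) ×
       ((∃[ A' ] (A' ∈ options A × IsP (A' ⊕ B))) ⊎ (∃[ B' ] (B' ∈ options B × IsP (A ⊕ B'))))
N-⊕⁻ A B n with N-elim {A ⊕ B} n
... | a , C , m , p with ∈-⊕⁻ A B m
...   | inj₁ (A' , l , refl) = active-⊕⁻ A B a , inj₁ (A' , l , p)
...   | inj₂ (B' , r , refl) = active-⊕⁻ A B a , inj₂ (B' , r , p)

P-⊕ : ∀ A B → (∀ {A'} → A' ∈ options A → IsN (A' ⊕ B)) →
      (∀ {B'} → B' ∈ options B → IsN (A ⊕ B')) → IsP (A ⊕ B)
P-⊕ A B l r = P-intro {A ⊕ B} λ m → go (∈-⊕⁻ A B m)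
  where
  go : (∃[ A' ] (A' ∈ options A × C ≡ A' ⊕ B)) ⊎ (∃[ B' ] (B' ∈ options B × C ≡ A ⊕ B')) → IsN C
  go (inj₁ (_ , m , refl)) = l m
  go (inj₂ (_ , m , refl)) = r m

o-injective : ∀ A B → o A ≡ o B → isN A ≡ isN B
o-injective A B e with isN A | isN B
... | true | true = refl
... | false | false = refl
o-injective A B () | true | false
o-injective A B () | false | true

o-cong : ∀ A B → isN A ≡ isN B → o A ≡ o B
o-cong A B e with isN A | isN B
o-cong A B refl | _ | true = refl
o-cong A B refl | _ | false = refl

≈⇒isN : ∀ A B → A ≈ B → ∀ X → isN (A ⊕ X) ≡ isN (B ⊕ X)
≈⇒isN A B e X = o-injective (A ⊕ X) (B ⊕ X) (e X)

≈-sym : A ≈ B → B ≈ A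
≈-sym e X = sym (e X)

≈-trans : A ≈ B → B ≈ C → A ≈ C
≈-trans e f X = trans (e X) (f X)

-- Recursion along options

_◃_ : Game → Game → Set
A' ◃ A = A' ∈ options A

◃-wellFounded : WellFounded _◃_
◃-wellFounded (mk As _) = acc (go As)
  where
  go : ∀ As {A} → A ∈ As → Acc _◃_ A
  go (A ∷ _) (here refl) = ◃-wellFounded A
  go (_ ∷ As) (there m) = go As m

open All ◃-wellFounded 0ℓ using () renaming (wfRec to ◃-rec)
open All (wellFounded _◃_ ◃-wellFounded) 0ℓ using () renaming (wfRec to ◃⁺-rec)

-- Mates

-- A + A is also a 𝒫-position, but A + A' may be inactive, hence 𝒫 rather
-- than 𝒩; making every position of the second summand active avoids this.
mutual
  activate : Game → Game
  activate (mk As _) = mk (activateAll As) true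

  activateAll : List Game → List Game
  activateAll [] = []
  activateAll (A ∷ As) = activate A ∷ activateAll As

activateAll≡map : ∀ As → activateAll As ≡ map activate As
activateAll≡map [] = refl
activateAll≡map (A ∷ As) = cong (activate A ∷_) (activateAll≡map As)

options-activate : ∀ A → options (activate A) ≡ map activate (options A)
options-activate (mk As _) = activateAll≡map As

activate-active : ∀ A → Active (activate A)
activate-active (mk _ _) = refl

mates : Game → List Game
mates A = map activate (options A)

-- A move to A' + T is answered by the mate of A' in T, which is possible because A' + T is active.
-- A move to the mate of A' is answered by moving from A to A'. Any other option of T must lose by
-- assumption.
mates-P : ∀ A T → (∀ {A'} → A' ◃ A → IsP (A' ⊕ activate A')) →
          (∀ {A'} → A' ◃ A → Active A' ⊎ Active T) →
          (∀ {B} → B ∈ mates A → B ◃ T) →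
          (∀ {B} → B ◃ T → B ∈ mates A ⊎ IsN (A ⊕ B)) → IsP (A ⊕ T)
mates-P A T ih act mates⊆T T⊆mates = P-⊕ A T
  (λ {A'} m → N-right A' T (act m) (mates⊆T (∈-map⁺ activate m)) (ih m))
  (reply ∘ T⊆mates)
  where
  reply : B ∈ mates A ⊎ IsN (A ⊕ B) → IsN (A ⊕ B)
  reply (inj₂ n) = n
  reply (inj₁ b) with ∈-map⁻ activate b
  ... | A' , m , refl = N-left A (activate A') (inj₂ (activate-active A')) m (ih m)

activate-P : ∀ A → IsP (A ⊕ activate A)
activate-P = ◃-rec (λ A → IsP (A ⊕ activate A)) λ A ih → mates-P A (activate A) ih
  (λ _ → inj₂ (activate-active A))
  (subst (_ ∈_) (sym (options-activate A)))
  (inj₁ ∘ subst (_ ∈_) (options-activate A))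

-- Separation and linking

-- Activeness of X keeps every sum with X open to moves, as `linked` requires.
Separated : Game → Game → Set
Separated A B = ∃[ X ] (Active X × IsP (A ⊕ X) × IsN (B ⊕ X))

-- Adding the mates of A to the option U lets the player to move win on B
-- (by moving to B + U) but not on A.
separate : ∀ A B U → IsN (A ⊕ U) → IsP (B ⊕ U) → Separated A B
separate A B U n p = T , refl ,
  mates-P A T (λ {A'} _ → activate-P A') (λ _ → inj₂ refl) there isMate ,
  N-right B T (inj₂ refl) (here refl) p
  where
  T = mk (U ∷ mates A) true

  isMate : C ◃ T → C ∈ mates A ⊎ IsN (A ⊕ C)
  isMate (here refl) = inj₂ n
  isMate (there m) = inj₁ m

Separated-sym : Separated A B → Separated B A
Separated-sym {A} {B} (X , _ , p , n) = separate B A X n p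

¬≈-Separated : A ≈ B → Separated A B → ⊥
¬≈-Separated {A} {B} e (X , _ , p , n) = N-P-disjoint {B ⊕ X} n (trans (sym (≈⇒isN A B e X)) p)

Linked : Game → Game → Set
Linked A B = ∃[ T ] (Active T × IsP (A ⊕ T) × IsP (B ⊕ T))

-- T collects the separating games. A move in A or B is answered in T by the separator of the option
-- reached. A move in T to the separator X of A' is answered in A by A', while B + X is 𝒩 by
-- separation; likewise with A and B exchanged.
linked : ∀ A B → (∀ {A'} → A' ◃ A → Separated A' B) → (∀ {B'} → B' ◃ B → Separated B' A) → Linked A B
linked A B f g = T , refl ,
  P-⊕ A T
    (λ {A'} m → let (_ , _ , p , _) = f m in N-right A' T (inj₂ refl) (∈-++⁺ˡ (mapWith∈⁺ (proj₁ ∘ f) (_ , m , refl))) p)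
    (λ m → N-A (∈-++⁻ Xs m)) ,
  P-⊕ B T
    (λ {B'} m → let (_ , _ , p , _) = g m in N-right B' T (inj₂ refl) (∈-++⁺ʳ Xs (mapWith∈⁺ (proj₁ ∘ g) (_ , m , refl))) p)
    (λ m → N-B (∈-++⁻ Xs m))
  where
  Xs = mapWith∈ (options A) (proj₁ ∘ f)
  Ys = mapWith∈ (options B) (proj₁ ∘ g)
  T = mk (Xs ++ Ys) true

  N-A : C ∈ Xs ⊎ C ∈ Ys → IsN (A ⊕ C)
  N-A (inj₁ c) with mapWith∈⁻ (options A) (proj₁ ∘ f) c
  ... | _ , m , refl = let (X , a , p , _) = f m in N-left A X (inj₂ a) m p
  N-A (inj₂ c) with mapWith∈⁻ (options B) (proj₁ ∘ g) c
  ... | _ , m , refl = let (_ , _ , _ , n) = g m in n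

  N-B : C ∈ Xs ⊎ C ∈ Ys → IsN (B ⊕ C)
  N-B (inj₁ c) with mapWith∈⁻ (options A) (proj₁ ∘ f) c
  ... | _ , m , refl = let (_ , _ , _ , n) = f m in n
  N-B (inj₂ c) with mapWith∈⁻ (options B) (proj₁ ∘ g) c
  ... | _ , m , refl = let (Y , a , p , _) = g m in N-left B Y (inj₂ a) m p

-- Deciding equality

Decided : Game → Game → Set
Decided A B = A ≈ B ⊎ Separated A B

Decided-sym : Decided A B → Decided B A
Decided-sym {A} {B} (inj₁ e) = inj₁ (≈-sym {A} {B} e)
Decided-sym {A} {B} (inj₂ s) = inj₂ (Separated-sym {A} {B} s)

search : {P Q : Game → Set} → ∀ As → (∀ {A} → A ∈ As → P A ⊎ Q A) →
         (∃[ A ] (A ∈ As × P A)) ⊎ (∀ {A} → A ∈ As → Q A)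
search [] f = inj₂ λ ()
search (A ∷ As) f with f (here refl) | search As (f ∘ there)
... | inj₁ p | _ = inj₁ (A , here refl , p)
... | inj₂ _ | inj₁ (B , m , p) = inj₁ (B , there m , p)
... | inj₂ q | inj₂ h = inj₂ λ { (here refl) → q ; (there m) → h m }

Answered : Game → Game → Set
Answered A' B = (∃[ B' ] (B' ◃ B × A' ≈ B')) ⊎ (∃[ A'' ] (A'' ◃ A' × A'' ≈ B))

-- If both searches fail, some T links A' and B: A + T is 𝒩 by the move to A' + T, while B + T is 𝒫.
-- Then `separate` applies.
answered? : ∀ A B → A' ◃ A → (∀ {B'} → B' ◃ B → Decided A' B') → (∀ {A''} → A'' ◃ A' → Decided A'' B) →
            Answered A' B ⊎ Separated A B
answered? {A'} A B m f g with search (options B) f | search (options A') g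
... | inj₁ h | _ = inj₁ (inj₁ h)
... | inj₂ _ | inj₁ h = inj₁ (inj₂ h)
... | inj₂ s | inj₂ t with linked A' B t (λ {B'} m → Separated-sym {A'} {B'} (s m))
...   | T , a , p , q = inj₂ (separate A B T (N-left A T (inj₂ a) m p) q)

HasInactive : Game → Set
HasInactive A = ∃[ A' ] (A' ◃ A × Inactive A')

-- An active A has an inactive option iff A + X is 𝒩 for every inactive X.  The
-- second field is needed because reversing through an inactive A' fails in
-- such a sum: the move to A' + X ends play before the reversing move.
record Simulated (A B : Game) : Set where
  field
    active : Active A → Active B
    hasInactive : Active A → HasInactive A → HasInactive B
    answered : ∀ {A'} → A' ◃ A → Answered A' B

active? : ∀ A B → (Active A → Active B) ⊎ Separated A B
active? A B with bool-cases (activeness A) | bool-cases (activeness B)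
... | inj₂ a | _ = inj₁ λ a' → contradiction (trans (sym a') a) λ ()
... | inj₁ _ | inj₁ b = inj₁ λ _ → b
-- With X inactive, B + X is inactive and so 𝒫, whereas A + X is active.
... | inj₁ a | inj₂ b = inj₂ (separate A B X
  (N-right A X (inj₁ a) (here refl) (activate-P A))
  (P-inactive-⊕ B X b refl))
  where X = mk (activate A ∷ []) false

hasInactive? : ∀ A B → (Active A → HasInactive A → HasInactive B) ⊎ Separated A B
hasInactive? A B
  with bool-cases (activeness A)
     | search (options A) (λ {A'} _ → ⊎-swap (bool-cases (activeness A')))
     | search (options B) (λ {B'} _ → ⊎-swap (bool-cases (activeness B')))
... | _ | _ | inj₁ h = inj₁ λ _ _ → h
... | _ | inj₂ f | _ = inj₁ λ { _ (_ , m , i) → contradiction (trans (sym (f m)) i) λ () }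
... | inj₂ a | _ | _ = inj₁ λ a' → contradiction (trans (sym a') a) λ ()
-- The move to the inactive A' + X wins in A + X. All options of B are active, so the mates still
-- answer every move in B + X.
... | inj₁ a | inj₁ (A' , m , i) | inj₂ f = inj₂ (separate A B X
  (N-left A X (inj₁ a) m (P-inactive-⊕ A' X i refl))
  (mates-P B X (λ {B'} _ → activate-P B') (inj₁ ∘ f) (λ b → b) inj₁))
  where X = mk (mates B) false

simulated? : ∀ A B → (∀ {A' B'} → A' ◃ A → B' ◃ B → Decided A' B') →
             (∀ {A' A''} → A' ◃ A → A'' ◃ A' → Decided A'' B) → Simulated A B ⊎ Separated A B
simulated? A B f g
  with active? A B | hasInactive? A B
     | search (options A) (λ m → ⊎-swap (answered? A B m (f m) (g m)))
... | inj₂ s | _ | _ = inj₂ s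
... | inj₁ _ | inj₂ s | _ = inj₂ s
... | inj₁ _ | inj₁ _ | inj₁ (_ , _ , s) = inj₂ s
... | inj₁ a | inj₁ i | inj₂ h = inj₁ record { active = a ; hasInactive = i ; answered = h }

-- A winning move in A + X is carried over to B + X, directly if it is in X or matched by an equal
-- option of B. If A' reverses through A'' equal to B and A' + X is active, then A' + X being 𝒫
-- forces A'' + X to be 𝒩.
Simulated-N : ∀ {X} → Simulated A B → (∀ {X'} → X' ◃ X → IsP (A ⊕ X') → IsP (B ⊕ X')) →
              IsN (A ⊕ X) → IsN (B ⊕ X)
Simulated-N {A} {B} {X} S ih n with N-⊕⁻ A X n
... | a , inj₂ (X' , m , p) = N-right B X (map₁ (Simulated.active S) a) m (ih m p)
... | a , inj₁ (A' , m , p) with Simulated.answered S m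
...   | inj₁ (B' , m' , e) =
        N-left B X (map₁ (Simulated.active S) a) m' (trans (sym (≈⇒isN A' B' e X)) p)
...   | inj₂ (A'' , m' , e) = go a (bool-cases (activeness A')) (bool-cases (activeness X))
  where
  reversed : Active A' ⊎ Active X → IsN (B ⊕ X)
  reversed a' with bool-cases (isN (A'' ⊕ X))
  ... | inj₁ n'' = trans (sym (≈⇒isN A'' B e X)) n''
  ... | inj₂ p'' = contradiction p (N-P-disjoint {A' ⊕ X} (N-left A' X a' m' p''))

  go : Active A ⊎ Active X → Active A' ⊎ Inactive A' → Active X ⊎ Inactive X → IsN (B ⊕ X)
  go _ (inj₁ a') _ = reversed (inj₁ a')
  go _ _ (inj₁ x) = reversed (inj₂ x)
  go (inj₂ x) _ (inj₂ ¬x) = contradiction (trans (sym x) ¬x) λ ()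
  -- Here A' + X is inactive and reversal gives nothing; an inactive option of B wins instead.
  go (inj₁ a) (inj₂ i) (inj₂ x) =
    let (B' , b , j) = Simulated.hasInactive S a (A' , m , i)
    in N-left B X (inj₁ (Simulated.active S a)) b (P-inactive-⊕ B' X j x)

iff⇒≡ : ∀ {b c} → (b ≡ true → c ≡ true) → (c ≡ true → b ≡ true) → b ≡ c
iff⇒≡ {true} f _ = sym (f refl)
iff⇒≡ {false} {true} _ g = g refl
iff⇒≡ {false} {false} _ _ = refl

-- Both directions go through one induction on X: carrying 𝒫 from A + X' to B + X' is the
-- contrapositive of carrying 𝒩 back.
simulated⇒≈ : Simulated A B → Simulated B A → A ≈ B
simulated⇒≈ {A} {B} S S' X = o-cong (A ⊕ X) (B ⊕ X) (◃-rec (λ X → isN (A ⊕ X) ≡ isN (B ⊕ X)) (λ X ih →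
  iff⇒≡ (Simulated-N S (λ m → trans (sym (ih m)))) (Simulated-N S' (λ m → trans (ih m)))) X)

-- Reversal descends two levels in one game while the other stays fixed, hence the transitive
-- closure. The outer recursion is on A for all B, the inner on B for fixed A.
_≈?_ : ∀ A B → Decided A B
_≈?_ = ◃⁺-rec (λ A → ∀ B → Decided A B) λ A ihA → ◃⁺-rec (Decided A) λ B ihB →
  decide A B (λ {_} {B'} m _ → ihA [ m ] B') (λ m m' → ihA (m' ∷ [ m ]) B) (λ m m' → ihB (m' ∷ [ m ]))
  where
  decide : ∀ A B → (∀ {A' B'} → A' ◃ A → B' ◃ B → Decided A' B') →
           (∀ {A' A''} → A' ◃ A → A'' ◃ A' → Decided A'' B) →
           (∀ {B' B''} → B' ◃ B → B'' ◃ B' → Decided A B'') → Decided A B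
  decide A B f g h
    with simulated? A B f g
       | simulated? B A (λ {B'} {A'} m m' → Decided-sym {A'} {B'} (f m' m)) (λ {_} {B''} m m' → Decided-sym {A} {B''} (h m m'))
  ... | inj₂ s | _ = inj₂ s
  ... | inj₁ _ | inj₂ s = inj₂ (Separated-sym {B} {A} s)
  ... | inj₁ S | inj₁ S' = inj₁ (simulated⇒≈ S S')

theorem3p41 : (G H : Game) → Canonical G → G ≈ H → CoveredBy G H
theorem3p41 G H (canonical _ irreversible) e {G'} m =
  conclude (answered? G H m (λ {H'} _ → G' ≈? H') (λ {G''} _ → G'' ≈? H))
  where
  conclude : Answered G' H ⊎ Separated G H → ∃[ H' ] (H' ◃ H × G' ≈ H')
  conclude (inj₁ (inj₁ covered)) = covered
  -- Since G'' = H = G, the option G' would be reversible.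
  conclude (inj₁ (inj₂ (G'' , m' , e'))) =
    contradiction (G'' , m' , ≈-trans {G''} {H} {G} e' (≈-sym {G} {H} e)) (irreversible m)
  conclude (inj₂ s) = contradiction s (¬≈-Separated {G} {H} e)
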